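{- Let $X$ be an equivalence-relational join space. The following conditions are equivalent: (1) $X$ is join-equivalence-relational. (2) $X$ is join-transitive. (3) For all $a,b,c\in X$, $a(bc)\subseteq(ab)c$. (4) For all $a,b,c,d\in X$, if $(c,b,a,d)$ is dependent, then $(a,b,c,d)$ is dependent. (5) $X$ is preprojective.
   Context: A join space is a set $X$ with a ternary relation $\langle\cdot,\cdot,\cdot\rangle$ on $X$ (a join relation) such that: $\langle a,x,x\rangle$ for all $a,x\in X$; $\langle x,b,y\rangle$ implies $\langle y,b,x\rangle$ for all $x,b,y\in X$; and $\langle x,y,x\rangle$ implies $y=x$ for all $x,y\in X$. For $a,c\in X$ put $ac:=\{x\in X\mid\langle a,x,c\rangle\}$. For subsets $A,B,C\subseteq X$, $\langle A,B,C\rangle$ means that there are $a\in A$, $b\in B$, $c\in C$ with $\langle a,b,c\rangle$, and $AC:=\{x\in X\mid \langle A,\{x\},C\rangle\}$, the union of all $ac$ with $a\in A$, $c\in C$. Singletons $\{x\}$ are written $x$ in these notations; e.g. $a(bc)$ is the join of $\{a\}$ with the set $bc$. For $A\subseteq X$: $X$ is $A$-transitive iff the binary relation $\langle A,\cdot,\cdot\rangle$ is transitive on $X$ (equivalently, for all $b,c\in X$, $\langle A,b,c\rangle$ implies $Ab\subseteq Ac$). $X$ is $A$-symmetric iff the binary relation $\langle A,\cdot,\cdot\rangle$ is symmetric on $X\setminus A$. $X$ is $A$-equivalence-relational iff it is $A$-transitive and $A$-symmetric. $X$ is transitive (resp. symmetric, equivalence-relational) iff it is $\{a\}$-transitive (resp.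 $\{a\}$-symmetric, $\{a\}$-equivalence-relational) for every $a\in X$. $X$ is join-transitive iff for all $a,b\in X$ it is $ab$-transitive. $X$ is join-equivalence-relational iff for all $a,b\in X$ it is $ab$-equivalence-relational (equivalently: $X$ is join-transitive and symmetric). A quadruple $(a,b,c,d)$ of elements of $X$ is dependent iff $b=a$ or $c\in ab$ or $d\in(ab)c$. $X$ is preprojective iff it is equivalence-relational and for all $a,b,c,d\in X$: if $b=c$ or $a=d$ or $bc\cap ad\neq\emptyset$, then $a=b$ or $c=d$ or $ab\cap cd\neq\emptyset$. -}

module Defs where

open import Level using (Level; _⊔_) renaming (suc to lsuc)
open import Data.Product using (_×_; ∃-syntax)
open import Data.Sum using (_⊎_)
open import Relation.Binary.Core using (Rel)
open import Relation.Binary.Definitions using (Transitive)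
open import Relation.Binary.PropositionalEquality using (_≡_)
open import Relation.Unary using (Pred; _∈_; _∉_; _⊆_; _∩_; ｛_｝; Satisfiable)

-- Join a x c is the join relation ⟨a,x,c⟩.
record JoinSpace (x ℓ : Level) : Set (lsuc (x ⊔ ℓ)) where
  field
    Carrier  : Set x
    Join     : Carrier → Carrier → Carrier → Set ℓ
    join-end : ∀ a x → Join a x x
    join-sym : ∀ x b y → Join x b y → Join y b x
    join-eq  : ∀ x y → Join x y x → y ≡ x

module _ {x ℓ : Level} (X : JoinSpace x ℓ) where
  open JoinSpace X

  private
    variable
      p q r : Level

  -- ⟨A,B,C⟩ for subsets.
  SetJoin : Pred Carrier p → Pred Carrier q → Pred Carrier r → Set _
  SetJoin A B C =
    ∃[ a ] ∃[ b ] ∃[ c ] (a ∈ A × b ∈ B × c ∈ C × Join a b c)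

  -- The subset ac for points a, c.
  join : Carrier → Carrier → Pred Carrier ℓ
  join a c x = Join a x c

  -- The subset AC for subsets A, C.
  setJoin : Pred Carrier p → Pred Carrier q → Pred Carrier _
  setJoin A C x = SetJoin A ｛ x ｝ C

  -- The binary relation ⟨A,·,·⟩.
  JoinFrom : Pred Carrier p → Rel Carrier _
  JoinFrom A b c = SetJoin A ｛ b ｝ ｛ c ｝

  TransitiveAt : Pred Carrier p → Set _
  TransitiveAt A = Transitive (JoinFrom A)

  -- Symmetry is only required outside A.
  SymmetricAt : Pred Carrier p → Set _
  SymmetricAt A = ∀ {b c} → b ∉ A → c ∉ A → JoinFrom A b c → JoinFrom A c b

  EquivalenceRelationalAt : Pred Carrier p → Set _
  EquivalenceRelationalAt A = TransitiveAt A × SymmetricAt A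

  EquivalenceRelational : Set _
  EquivalenceRelational = ∀ a → EquivalenceRelationalAt ｛ a ｝

  JoinTransitive : Set _
  JoinTransitive = ∀ a b → TransitiveAt (join a b)

  JoinEquivalenceRelational : Set _
  JoinEquivalenceRelational = ∀ a b → EquivalenceRelationalAt (join a b)

  JoinAssociative : Set _
  JoinAssociative =
    ∀ a b c → setJoin ｛ a ｝ (join b c) ⊆ setJoin (join a b) ｛ c ｝

  Dependent : Carrier → Carrier → Carrier → Carrier → Set _
  Dependent a b c d =
    b ≡ a ⊎ c ∈ join a b ⊎ d ∈ setJoin (join a b) ｛ c ｝

  DependenceExchange : Set _
  DependenceExchange = ∀ a b c d → Dependent c b a d → Dependent a b c d

  Preprojective : Set _
  Preprojective = EquivalenceRelational ×
    (∀ a b c d →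
      b ≡ c ⊎ a ≡ d ⊎ Satisfiable (join b c ∩ join a d) →
      a ≡ b ⊎ c ≡ d ⊎ Satisfiable (join a b ∩ join c d))

{-# OPTIONS --safe #-}
-- In an equivalence-relational join space two distinct points of a line determine it, so J a b c
-- says that b lies on the line ac.  Condition (3) is then the axiom of Pasch, and (2), (4) and (5)
-- are rearrangements of it that differ only in degenerate and collinear configurations, which
-- are settled by exchanging points on a line.
module Submission where

open import Defs
open import Level using (Level; _⊔_; Lift; lift; lower)
open import Axiom.ExcludedMiddle using (ExcludedMiddle)
open import Data.Product using (_×_; _,_; proj₁; proj₂)
open import Data.Sum using (_⊎_; inj₁; inj₂)
open import Function using (_∘_)
open import Function.Bundles using (_⇔_; mk⇔)
open import Relation.Binary.Definitions using (DecidableEquality)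
open import Relation.Binary.PropositionalEquality using (_≡_; _≢_; refl; sym)
open import Relation.Unary using (Satisfiable; _∩_; ｛_｝)
open import Relation.Nullary using (yes; no)
open import Relation.Nullary.Decidable using (map′)

module EquivalenceRelationalSpace {x ℓ : Level} (X : JoinSpace x ℓ)
  (er : EquivalenceRelational X) (_≟_ : DecidableEquality (JoinSpace.Carrier X)) where

  open JoinSpace X renaming (Join to J)

  join-start : ∀ a x → J a a x
  join-start a x = join-sym x a a (join-end x a)

  join-trans : ∀ {a b c d} → J a b c → J a c d → J a b d
  join-trans {a} {b} {c} {d} abc acd
    with _ , _ , _ , refl , refl , refl , abd ←
      proj₁ (er a) (a , b , c , refl , refl , refl , abc) (a , c , d , refl , refl , refl , acd)
    = abd

  -- Symmetry at `a` holds only away from `a`, and `c ≡ a` is excluded because `join-eq` would then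
  -- give `b ≡ a`.
  join-exchange : ∀ {a b c} → a ≢ b → J a b c → J a c b
  join-exchange {a} {b} {c} a≢b abc
    with _ , _ , _ , refl , refl , refl , acb ←
      proj₂ (er a) a≢b (λ { refl → a≢b (sym (join-eq a b abc)) }) (a , b , c , refl , refl , refl , abc)
    = acb

  -- For `a ≢ w` the exchange puts `b`, hence `u`, on the line `aw`. Transitivity at `w` then
  -- carries `v` onto that line, and transitivity at `a` onto `ab`.
  join-convex : ∀ {a b u v w} → J a u b → J a w b → J u v w → J a v b
  join-convex {a} {w = w} aub awb uvw with a ≟ w
  ... | yes refl = join-trans (join-sym _ _ _ uvw) aub
  ... | no a≢w   = join-trans avw awb
    where
    auw = join-trans aub (join-exchange a≢w awb)
    avw = join-sym _ _ _ (join-trans (join-sym _ _ _ uvw) (join-sym _ _ _ auw))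

  -- The base point `u` lies in `ab` and the middle point `v` does not, so they differ and can be
  -- exchanged pointwise.
  joinTransitive⇒joinEquivalenceRelational : JoinTransitive X → JoinEquivalenceRelational X
  joinTransitive⇒joinEquivalenceRelational jt a b = jt a b ,
    λ { b∉A _ (u , v , w , u∈A , refl , refl , uvw) →
        u , w , v , u∈A , refl , refl , join-exchange (λ { refl → b∉A u∈A }) uvw }

  -- Both `a` and `b` lie in `ab`, so `y` precedes `z` and `z` precedes `c` in the relation given by
  -- `ab`.
  joinTransitive⇒joinAssociative : JoinTransitive X → JoinAssociative X
  joinTransitive⇒joinAssociative jt a b c (_ , y , z , refl , refl , bzc , ayz) =
    jt a b (a , y , z , join-start a b , refl , refl , ayz)
           (b , z , c , join-end a b , refl , refl , bzc)

  joinAssociative⇒joinTransitive : JoinAssociative X → JoinTransitive X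
  joinAssociative⇒joinTransitive ja a b
    (u , p , q , aub , refl , refl , upq) (v , _ , r , avb , refl , refl , vqr)
    -- Here `p` lies in `u(vr)`. Associativity moves it to `(uv)r`, and convexity returns the new
    -- base point `w` to `ab`.
    with w , _ , _ , uwv , refl , refl , wpr ← ja u v r (u , p , q , refl , refl , vqr , upq)
    = w , p , r , join-convex aub avb uwv , refl , refl , wpr

  joinAssociative⇒dependenceExchange : JoinAssociative X → DependenceExchange X
  joinAssociative⇒dependenceExchange ja a b c d (inj₁ refl) = inj₂ (inj₁ (join-end a b))
  joinAssociative⇒dependenceExchange ja a b c d (inj₂ (inj₁ cab)) with b ≟ a
  ... | yes b≡a = inj₁ b≡a
  ... | no b≢a  = inj₂ (inj₁ (join-sym _ _ _ (join-exchange b≢a (join-sym _ _ _ cab))))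
  joinAssociative⇒dependenceExchange ja a b c d
    (inj₂ (inj₂ (w , _ , _ , cwb , refl , refl , wda))) =
    -- By symmetry of the join, `(cb)a` is `a(bc)`, so this case is associativity itself.
    inj₂ (inj₂ (ja a b c (a , d , w , refl , refl , join-sym _ _ _ cwb , join-sym _ _ _ wda)))

  -- The degenerate case `b ≡ a` of associativity: `y` is already on `ac`.
  pasch-coincident : ∀ {a c y z} → J a z c → J a y z → setJoin X (join X a a) ｛ c ｝ y
  pasch-coincident {a} {c} {y} azc ayz =
    a , y , c , join-end a a , refl , refl , join-trans ayz azc

  -- The degenerate case where `c` lies on `ab`: `z` and then `y` fall into `ab`, so `y` serves as
  -- its own base point.
  pasch-collinear : ∀ {a b c y z} → J a c b → J b z c → J a y z → setJoin X (join X a b) ｛ c ｝ y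
  pasch-collinear {c = c} {y} acb bzc ayz =
    y , y , c , join-trans ayz azb , refl , refl , join-start y c
    where azb = join-sym _ _ _ (join-trans bzc (join-sym _ _ _ acb))

  dependenceExchange⇒joinAssociative : DependenceExchange X → JoinAssociative X
  dependenceExchange⇒joinAssociative de a b c (_ , y , z , refl , refl , bzc , ayz)
    with de a b c y
      (inj₂ (inj₂ (z , y , a , join-sym _ _ _ bzc , refl , refl , join-sym _ _ _ ayz)))
  ... | inj₁ refl         = pasch-coincident bzc ayz
  ... | inj₂ (inj₁ acb)   = pasch-collinear acb bzc ayz
  ... | inj₂ (inj₂ y∈abc) = y∈abc

  joinAssociative⇒preprojective : JoinAssociative X → Preprojective X
  joinAssociative⇒preprojective ja = er , exchange
    where
    exchange : ∀ a b c d → b ≡ c ⊎ a ≡ d ⊎ Satisfiable (join X b c ∩ join X a d) →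
               a ≡ b ⊎ c ≡ d ⊎ Satisfiable (join X a b ∩ join X c d)
    exchange a b c d (inj₁ refl)        = inj₂ (inj₂ (b , join-end a b , join-start b d))
    exchange a b c d (inj₂ (inj₁ refl)) = inj₂ (inj₂ (a , join-start a b , join-end c a))
    exchange a b c d (inj₂ (inj₂ (z , bzc , azd))) with a ≟ b | c ≟ d | a ≟ z
    ... | yes a≡b | _       | _        = inj₁ a≡b
    ... | no _    | yes c≡d | _        = inj₂ (inj₁ c≡d)
    -- Now `a` is on `bc`, so `c` is on `ab` and is itself the common point.
    ... | no a≢b  | no _    | yes refl = inj₂ (inj₂
      (c , join-sym _ _ _ (join-exchange (a≢b ∘ sym) bzc) , join-start c d))
    ... | no _    | no c≢d  | no a≢z
      -- Exchanging `z` and `d` on their line through `a` places `d` in `a(bc)`. The point `w` of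
      -- `ab` with `d` on `wc` is then on `cd` after an exchange at `c`.
      with w , _ , _ , awb , refl , refl , wdc ←
        ja a b c (a , d , z , refl , refl , bzc , join-exchange a≢z azd)
      = inj₂ (inj₂ (w , awb , join-exchange c≢d (join-sym _ _ _ wdc)))

  preprojective⇒joinAssociative : Preprojective X → JoinAssociative X
  preprojective⇒joinAssociative (_ , exchange) a b c (_ , y , z , refl , refl , bzc , ayz)
    with a ≟ y
  ... | yes refl = a , a , c , join-start a b , refl , refl , join-start a c
  -- Since `a ≢ y`, `z` is on `ay` and is a common point of `bc` and `ay`.
  ... | no a≢y with exchange a b c y (inj₂ (inj₂ (z , bzc , join-exchange a≢y ayz)))
  ...   | inj₁ refl        = pasch-coincident bzc ayz
  ...   | inj₂ (inj₁ refl) = a , c , c , join-start a b , refl , refl , join-end a c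
  ...   | inj₂ (inj₂ (p , apb , cpy)) with c ≟ p
  -- If `ab` and `cy` meet in `c`, no exchange at `c` is possible, but then `c` is on `ab`.
  ...     | yes refl = pasch-collinear apb bzc ayz
  ...     | no c≢p   =
    p , y , c , apb , refl , refl , join-sym _ _ _ (join-exchange c≢p cpy)

theorem5p2 : ∀ {x ℓ : Level} → ExcludedMiddle (x ⊔ ℓ) →
    (X : JoinSpace x ℓ) → EquivalenceRelational X →
    (JoinEquivalenceRelational X ⇔ JoinTransitive X) ×
    (JoinTransitive X ⇔ JoinAssociative X) ×
    (JoinAssociative X ⇔ DependenceExchange X) ×
    (DependenceExchange X ⇔ Preprojective X)
theorem5p2 {x} {ℓ} em X er =
  mk⇔ (λ jer a b → proj₁ (jer a b)) joinTransitive⇒joinEquivalenceRelational ,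
  mk⇔ joinTransitive⇒joinAssociative joinAssociative⇒joinTransitive ,
  mk⇔ joinAssociative⇒dependenceExchange dependenceExchange⇒joinAssociative ,
  mk⇔ (joinAssociative⇒preprojective ∘ dependenceExchange⇒joinAssociative)
      (joinAssociative⇒dependenceExchange ∘ preprojective⇒joinAssociative)
  where
  -- Equality of points lives at level `x`, so it is lifted to the level of `em`.
  open EquivalenceRelationalSpace X er (λ a b → map′ lower lift (em {P = Lift (x ⊔ ℓ) (a ≡ b)}))
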